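{- The type $V = \sum_{X:\mathcal U^{\leq 0}}\mathrm{inV}(X)$ is $0$-truncated (a set).
   Context: Homotopy type theory with function extensionality and higher inductive families, and larger universes univalent for contractible types. $\mathcal U^{\leq 0}$ is a univalent universe of sets ($0$-truncated types), closed under dependent products. $M$ is a set and $N : M\to\mathcal U^{\leq 0}$. The family $\mathrm{inV}$ over $\mathcal U^{\leq 0}$ is the higher inductive family with constructors: (i) for $m:M$, $w_N(m):\mathrm{inV}(N(m))$; (ii) for $A:\mathcal U^{\leq 0}$, $B:A\to\mathcal U^{\leq 0}$, $w_A:\mathrm{inV}(A)$ and $w_B : \prod_{a:A}\mathrm{inV}(B(a))$, $w_\Pi(w_A,w_B):\mathrm{inV}(\prod_{a:A}B(a))$; (iii) for a proposition $X:\mathcal U^{\leq 0}$ and $w_0,w_1:\mathrm{inV}(X)$, a path $\mathrm{ua}(w_0,w_1):w_0=w_1$. -}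

{-# OPTIONS --without-K #-}
module Defs where

open import Level using (Level; _⊔_; suc; zero; Setω)
open import Data.Product using (Σ; Σ-syntax; _,_; proj₁; proj₂)
open import Relation.Binary.PropositionalEquality
  using (_≡_; refl; sym; trans; cong; subst)

private variable a b ℓ : Level

isContr : Set a → Set a
isContr A = Σ A λ c → (x : A) → c ≡ x

isProp : Set a → Set a
isProp A = (x y : A) → x ≡ y

isSet : Set a → Set a
isSet A = (x y : A) → isProp (x ≡ y)

fiber : {A : Set a} {B : Set b} → (A → B) → B → Set (a ⊔ b)
fiber {A = A} f y = Σ A λ x → f x ≡ y

isEquiv : {A : Set a} {B : Set b} → (A → B) → Set (a ⊔ b)
isEquiv {B = B} f = (y : B) → isContr (fiber f y)

_≃_ : Set a → Set b → Set (a ⊔ b)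
A ≃ B = Σ (A → B) isEquiv

idEquiv : (A : Set a) → A ≃ A
idEquiv A = (λ x → x) , λ y → (y , refl) , λ { (x , refl) → refl }

idtoeqv : {A B : Set a} → A ≡ B → A ≃ B
idtoeqv {A = A} refl = idEquiv A

apd : {A : Set a} {P : A → Set b} (f : (x : A) → P x) {x y : A}
      (p : x ≡ y) → subst P p (f x) ≡ f y
apd f refl = refl

happly : {A : Set a} {B : A → Set b} {f g : (x : A) → B x} →
         f ≡ g → (x : A) → f x ≡ g x
happly refl x = refl

Funext : Setω
Funext = ∀ {a b} {A : Set a} {B : A → Set b} (f g : (x : A) → B x) →
         isEquiv (happly {f = f} {g = g})

module _ (fe : Funext) where

  funext : {A : Set a} {B : A → Set b} {f g : (x : A) → B x} →
           ((x : A) → f x ≡ g x) → f ≡ g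
  funext {f = f} {g} h = proj₁ (proj₁ (fe f g h))

  isSet-Π : {A : Set a} {B : A → Set b} → ((x : A) → isSet (B x)) →
            isSet ((x : A) → B x)
  isSet-Π {B = B} sB f g p q =
    trans (sym (cong proj₁ (proj₂ (fe f g (happly q)) (p , e))))
          (cong proj₁ (proj₂ (fe f g (happly q)) (q , refl)))
    where
    e : happly p ≡ happly q
    e = funext (λ x → sB x (f x) (g x) (happly p x) (happly q x))

hSet : Set₁
hSet = Σ Set isSet

El : hSet → Set
El = proj₁

Πˢ : Funext → (A : hSet) → (El A → hSet) → hSet
Πˢ fe A B = ((a : El A) → El (B a)) , isSet-Π fe (λ a → proj₂ (B a))

UnivalentSets : Set₁
UnivalentSets = (A B : hSet) → isEquiv (λ (p : A ≡ B) → idtoeqv (cong El p))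

ContrUnivalence : Setω
ContrUnivalence = ∀ {ℓ} (A B : Set ℓ) → isContr A → isContr B →
                  isEquiv (idtoeqv {A = A} {B = B})

-- The higher inductive family inV over U^{≤0}, given by its constructors,
-- its dependent eliminator, and computation rules (propositional).
record InV (fe : Funext) (M : Set) (N : M → hSet) : Setω where
  field
    inV : hSet → Set₁
    wN  : (m : M) → inV (N m)
    wΠ  : (A : hSet) (B : El A → hSet) →
          inV A → ((a : El A) → inV (B a)) → inV (Πˢ fe A B)
    uaW : (X : hSet) → isProp (El X) → (w₀ w₁ : inV X) → w₀ ≡ w₁
    elim : ∀ {ℓ} (P : (X : hSet) → inV X → Set ℓ)
      (pN : (m : M) → P (N m) (wN m))
      (pΠ : (A : hSet) (B : El A → hSet) (wA : inV A)
            (wB : (a : El A) → inV (B a)) →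
            P A wA → ((a : El A) → P (B a) (wB a)) →
            P (Πˢ fe A B) (wΠ A B wA wB))
      (pua : (X : hSet) (h : isProp (El X)) (w₀ w₁ : inV X)
             (p₀ : P X w₀) (p₁ : P X w₁) →
             subst (P X) (uaW X h w₀ w₁) p₀ ≡ p₁) →
      (X : hSet) (w : inV X) → P X w
    elim-wN : ∀ {ℓ} P pN pΠ pua (m : M) →
      elim {ℓ} P pN pΠ pua (N m) (wN m) ≡ pN m
    elim-wΠ : ∀ {ℓ} P pN pΠ pua (A : hSet) (B : El A → hSet) (wA : inV A)
      (wB : (a : El A) → inV (B a)) →
      elim {ℓ} P pN pΠ pua (Πˢ fe A B) (wΠ A B wA wB)
        ≡ pΠ A B wA wB (elim P pN pΠ pua A wA)
             (λ a → elim P pN pΠ pua (B a) (wB a))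
    elim-uaW : ∀ {ℓ} P pN pΠ pua (X : hSet) (h : isProp (El X))
      (w₀ w₁ : inV X) →
      apd (elim {ℓ} P pN pΠ pua X) (uaW X h w₀ w₁)
        ≡ pua X h w₀ w₁ (elim P pN pΠ pua X w₀) (elim P pN pΠ pua X w₁)

{-# OPTIONS --without-K #-}
module Submission where

-- We show that every path space x ≡ v in V is a proposition, by induction on
-- the inV-component of x; the motive is a proposition, so the path
-- constructor uaW costs nothing.  Each point-constructor case is an
-- encode-decode argument in the form of a local HoTT Lemma 7.2.2
-- (pathsProp-fromCode): it suffices to find a proposition-valued family R
-- on V with R x and a map R v → x ≡ v.  For x = c(t₀) built by a constructor
-- c from arguments t₀, the code R (Y , w') consists of an equivalence
-- e : X ≃ Y together with the disjunction "X is a proposition, or w' is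
-- c(t) with a path t₀ ≡ t inducing e".  R is defined by eliminating inV; the
-- disjunct "X is a proposition" makes the codes over a propositional Y
-- contractible, so by univalence for contractible types they all agree,
-- which is exactly the uaW case of that elimination.

open import Defs
open import Level using (Level; _⊔_; Lift; lift; lower) renaming (suc to lsuc; zero to lzero)
open import Data.Product using (Σ; _,_; proj₁; proj₂)
open import Data.Product.Properties using (Σ-≡,≡→≡)
open import Data.Unit using (⊤; tt)
open import Data.Empty.Polymorphic using (⊥)
open import Function using (id)
open import Relation.Binary.PropositionalEquality
  using (_≡_; refl; sym; trans; cong; subst; module ≡-Reasoning)
open import Relation.Binary.PropositionalEquality.Properties using (trans-reflʳ; trans-symˡ)

private variable a b d ℓ : Level

pathsProp-fromCode : {A : Set a} {x : A} (R : A → Set b) → ((y : A) → isProp (R y)) →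
                     R x → ((y : A) → R y → x ≡ y) → (y : A) → isProp (x ≡ y)
pathsProp-fromCode {A = A} {x} R R-prop r decode y p q = begin
  p                                                ≡⟨ canonical p ⟩
  trans (sym (decode x r)) (decode y (subst R p r)) ≡⟨ cong (λ s → trans (sym (decode x r)) (decode y s))
                                                            (R-prop y _ _) ⟩
  trans (sym (decode x r)) (decode y (subst R q r)) ≡⟨ sym (canonical q) ⟩
  q                                                ∎
  where
  open ≡-Reasoning
  canonical : {y : A} (p : x ≡ y) → p ≡ trans (sym (decode x r)) (decode y (subst R p r))
  canonical refl = sym (trans-symˡ (decode x r))

prop→set : {A : Set a} → isProp A → isSet A
prop→set A-prop x = pathsProp-fromCode (λ _ → ⊤) (λ _ _ _ → refl) tt (λ y _ → A-prop x y)

contr→prop : {A : Set a} → isContr A → isProp A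
contr→prop (c , c-centre) x y = trans (sym (c-centre x)) (c-centre y)

Σ≡prop : {A : Set a} {B : A → Set b} → ((x : A) → isProp (B x)) →
         {u v : Σ A B} → proj₁ u ≡ proj₁ v → u ≡ v
Σ≡prop B-prop {x , y} {.x , y'} refl = cong (x ,_) (B-prop x y y')

isProp-Σ : {A : Set a} {B : A → Set b} → isProp A → ((x : A) → isProp (B x)) →
           isProp (Σ A B)
isProp-Σ A-prop B-prop u v = Σ≡prop B-prop (A-prop (proj₁ u) (proj₁ v))

retract-prop : {A : Set a} {B : Set b} (f : A → B) (g : B → A) →
               ((x : A) → g (f x) ≡ x) → isProp B → isProp A
retract-prop f g gf B-prop x y = trans (sym (gf x)) (trans (cong g (B-prop (f x) (f y))) (gf y))

sym-sym : {A : Set a} {x y : A} (p : x ≡ y) → sym (sym p) ≡ p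
sym-sym refl = refl

isProp-sym : {A : Set a} {x y : A} → isProp (y ≡ x) → isProp (x ≡ y)
isProp-sym = retract-prop sym sym sym-sym

subst-const : {A : Set a} {C : Set b} {x y : A} (p : x ≡ y) (z : C) →
              subst (λ _ → C) p z ≡ z
subst-const refl z = refl

-- Paths out of (x , y) in a Σ-type are propositions when paths out of x and
-- paths out of y are: code such a path by its two components.
Σ-pathsProp : {A : Set a} {B : A → Set b} {x : A} {y : B x} →
              ((x' : A) → isProp (x ≡ x')) → ((y' : B x) → isProp (y ≡ y')) →
              (u : Σ A B) → isProp ((x , y) ≡ u)
Σ-pathsProp {a = a} {b = b} {A = A} {B} {x} {y} x-paths y-paths =
  pathsProp-fromCode Code Code-prop (refl , refl) (λ _ → Σ-≡,≡→≡)
  where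
  Code : Σ A B → Set (a ⊔ b)
  Code (x' , y') = Σ (x ≡ x') (λ p → subst B p y ≡ y')
  transported-paths : {x' : A} (p : x ≡ x') (y' : B x') → isProp (subst B p y ≡ y')
  transported-paths refl = y-paths
  Code-prop : (u : Σ A B) → isProp (Code u)
  Code-prop (x' , y') = isProp-Σ (x-paths x') (λ p → transported-paths p y')

-- Impredicative disjunction of P and Q, eliminating into propositions of
-- level ℓ (a propositionally truncated sum).
Or : (ℓ : Level) → Set a → Set b → Set (lsuc ℓ ⊔ a ⊔ b)
Or ℓ P Q = (R : Set ℓ) → isProp R → (P → R) → (Q → R) → R

inl : {P : Set a} {Q : Set b} → P → Or ℓ P Q
inl p _ _ f _ = f p

inr : {P : Set a} {Q : Set b} → Q → Or ℓ P Q
inr q _ _ _ g = g q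

module WithFunext (fe : Funext) where

  isProp-Π : {A : Set a} {B : A → Set b} → ((x : A) → isProp (B x)) → isProp ((x : A) → B x)
  isProp-Π B-prop f g = funext fe (λ x → B-prop x (f x) (g x))

  isProp-isProp : {A : Set a} → isProp (isProp A)
  isProp-isProp f g = funext fe (λ x → funext fe (λ y → prop→set f x y (f x y) (g x y)))

  isProp-isContr : {A : Set a} → isProp (isContr A)
  isProp-isContr (c , c-centre) (c' , c'-centre) =
    Σ≡prop (λ z → isProp-Π (λ y → prop→set (contr→prop (c , c-centre)) z y)) (c-centre c')

  funPathsProp : {A : Set a} {B : A → Set b} {f g : (x : A) → B x} →
                 ((x : A) → isProp (f x ≡ g x)) → isProp (f ≡ g)
  funPathsProp {f = f} {g} pointwise p q =
    cong proj₁ (contr→prop (fe f g (happly q)) (p , isProp-Π pointwise _ _) (q , refl))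

  equiv-≡ : {A : Set a} {B : Set b} {e₁ e₂ : A ≃ B} → proj₁ e₁ ≡ proj₁ e₂ → e₁ ≡ e₂
  equiv-≡ = Σ≡prop (λ f → isProp-Π (λ y → isProp-isContr))

  ≃-preserves-prop : {A : Set a} {B : Set b} → A ≃ B → isProp A → isProp B
  ≃-preserves-prop (f , f-equiv) A-prop y₁ y₂ =
    trans (sym (proj₂ (proj₁ (f-equiv y₁))))
      (trans (cong f (A-prop _ _)) (proj₂ (proj₁ (f-equiv y₂))))

  ≃-reflects-prop : {A : Set a} {B : Set b} → A ≃ B → isProp B → isProp A
  ≃-reflects-prop (f , f-equiv) B-prop x y =
    cong proj₁ (contr→prop (f-equiv (f y)) (x , B-prop (f x) (f y)) (y , refl))

  isProp-≃ : {A : Set a} {B : Set b} → isProp A → isProp (A ≃ B)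
  isProp-≃ A-prop e₁ e₂ = equiv-≡ (funext fe (λ x → ≃-preserves-prop e₁ A-prop _ _))

  contr-equiv : {A : Set a} {B : Set b} → isContr A → isContr B → A ≃ B
  contr-equiv A-contr B-contr = (λ _ → proj₁ B-contr) , λ y →
    (proj₁ A-contr , proj₂ B-contr y) ,
    λ z → isProp-Σ (contr→prop A-contr) (λ _ → prop→set (contr→prop B-contr) _ _) _ z

  isProp-Or : {P : Set a} {Q : Set b} → isProp (Or ℓ P Q)
  isProp-Or = isProp-Π (λ R → isProp-Π (λ R-prop → isProp-Π (λ _ → isProp-Π (λ _ → R-prop))))

  -- Elimination of P ∨ Q into a type D that is a proposition whenever P
  -- holds: no coherence between the branches has to be supplied.  We
  -- eliminate into T = Σ (d : D) (∀ q → d ≡ dQ q), a proposition under P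
  -- (as D is) and under Q (as a singleton), hence under P ∨ Q.
  Or-elim : {P : Set a} {Q : Set b} {D : Set d} → isProp Q → (P → isProp D) →
            (P → D) → (Q → D) → Or (d ⊔ b) P Q → D
  Or-elim {b = b} {d = d} {P = P} {Q} {D} Q-prop D-prop dP dQ o = proj₁ (o T T-prop fromP fromQ)
    where
    T : Set (d ⊔ b)
    T = Σ D (λ z → (q : Q) → z ≡ dQ q)

    singleton-prop : {z : D} → isProp (Σ D (λ y → y ≡ z))
    singleton-prop (y , refl) (.y , refl) = refl

    along : {z : D} (h : (q : Q) → z ≡ dQ q) {q₁ q₂ : Q} (s : q₁ ≡ q₂) →
            trans (h q₁) (cong dQ s) ≡ h q₂
    along h {q₁} refl = trans-reflʳ (h q₁)

    T-prop-Q : Q → isProp T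
    T-prop-Q q₀ = retract-prop (λ (z , h) → z , h q₀) (λ (z , π) → z , λ q → trans π (cong dQ (Q-prop q₀ q)))
                    (λ (z , h) → cong (z ,_) (funext fe (λ q → along h (Q-prop q₀ q)))) singleton-prop

    T-prop-P : P → isProp T
    T-prop-P p = isProp-Σ (D-prop p) (λ z → isProp-Π (λ q → prop→set (D-prop p) _ _))

    T-prop : isProp T
    T-prop = o (isProp T) isProp-isProp T-prop-P T-prop-Q

    fromP : P → T
    fromP p = dP p , λ q → D-prop p _ _

    fromQ : Q → T
    fromQ q = dQ q , λ q' → cong dQ (Q-prop q q')

module Proof (fe : Funext) (univ : UnivalentSets) (contr-univ : ContrUnivalence)
             (M : Set) (M-set : isSet M) (N : M → hSet) (I : InV fe M N) where
  open WithFunext fe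
  open InV I

  V : Set₁
  V = Σ hSet inV

  conN : M → V
  conN m = N m , wN m

  ΠArgs : Set₁
  ΠArgs = Σ V (λ a → El (proj₁ a) → V)

  conΠ : ΠArgs → V
  conΠ ((A , wA) , b) = Πˢ fe A (λ a → proj₁ (b a)) , wΠ A (λ a → proj₁ (b a)) wA (λ a → proj₂ (b a))

  argsOf : (A : hSet) (B : El A → hSet) → inV A → ((a : El A) → inV (B a)) → ΠArgs
  argsOf A B wA wB = (A , wA) , λ a → B a , wB a

  ua : {X Y : hSet} → El X ≃ El Y → X ≡ Y
  ua {X} {Y} e = proj₁ (proj₁ (univ X Y e))

  -- An equivalence out of a proposition X yields a path in V, since any two
  -- inhabitants of inV over a proposition are identified by uaW.
  pathFromEquiv : {X Y : hSet} (w : inV X) (w' : inV Y) → isProp (El X) → El X ≃ El Y →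
                  (X , w) ≡ (Y , w')
  pathFromEquiv {Y = Y} w w' X-prop e =
    Σ-≡,≡→≡ (ua e , uaW Y (≃-preserves-prop e X-prop) _ _)

  -- Over a proposition X, paths out of (X , w) are propositions: they are
  -- coded by equivalences X ≃ Y, which form a proposition.
  propPaths : {X : hSet} → isProp (El X) → (w : inV X) (v : V) → isProp ((X , w) ≡ v)
  propPaths {X} X-prop w = pathsProp-fromCode (λ v → El X ≃ El (proj₁ v)) (λ _ → isProp-≃ X-prop)
                             (idEquiv (El X)) (λ (Y , w') e → pathFromEquiv w w' X-prop e)

  contr-≡ : {A B : Set ℓ} → isContr A → isContr B → A ≡ B
  contr-≡ A-contr B-contr = proj₁ (proj₁ (contr-univ _ _ A-contr B-contr (contr-equiv A-contr B-contr)))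

  -- How a point x may match the image of a constructor con: for each t and
  -- equivalence e a proposition S t e, determining e, and giving x ≡ con t.
  record Matching (x : V) {T : Set ℓ} (con : T → V) : Set (lsuc ℓ ⊔ lsuc lzero) where
    field
      S      : (t : T) → El (proj₁ x) ≃ El (proj₁ (con t)) → Set ℓ
      S-prop : (t : T) (e : El (proj₁ x) ≃ El (proj₁ (con t))) → isProp (S t e)
      S-uniq : (t : T) {e₁ e₂ : El (proj₁ x) ≃ El (proj₁ (con t))} → S t e₁ → S t e₂ → proj₁ e₁ ≡ proj₁ e₂
      S-dec  : (t : T) (e : El (proj₁ x) ≃ El (proj₁ (con t))) → S t e → x ≡ con t
  open Matching

  -- x = con t₀ matches con t along the paths t₀ ≡ t, inducing e by transport;
  -- this works when paths out of t₀ are propositions.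
  matchBy : {T : Set ℓ} (con : T → V) (t₀ : T) → ((t : T) → isProp (t₀ ≡ t)) → Matching (con t₀) con
  matchBy con t₀ t₀-paths = record
    { S      = λ t e → Σ (t₀ ≡ t) (λ p → proj₁ e ≡ subst (λ t → El (proj₁ (con t))) p)
    ; S-prop = λ t e → isProp-Σ (t₀-paths t) (λ p → isSet-Π fe (λ _ → proj₂ (proj₁ (con t))) _ _)
    ; S-uniq = λ t (p₁ , e₁≡p₁) (p₂ , e₂≡p₂) →
                 trans e₁≡p₁ (trans (cong (subst _) (t₀-paths t p₁ p₂)) (sym e₂≡p₂))
    ; S-dec  = λ t e (p , _) → cong con p }

  -- A point built by a different constructor matches nothing.
  noMatch : {x : V} {T : Set ℓ} {con : T → V} → Matching x con
  noMatch = record { S = λ _ _ → ⊥ ; S-prop = λ _ _ () ; S-uniq = λ _ () ; S-dec = λ _ _ () }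

  module Codes (x : V) (μN : Matching x conN) (μΠ : Matching x conΠ) where
    X : hSet
    X = proj₁ x

    Alt : {B : Set} → (El X ≃ B → Set ℓ) → El X ≃ B → Set (lsuc (lsuc lzero ⊔ ℓ))
    Alt {ℓ = ℓ} S e = Or (lsuc lzero ⊔ ℓ) (isProp (El X)) (S e)

    CodeFamily : hSet → Set₃
    CodeFamily Y = Σ (El X ≃ El Y → Set₂) (λ g → (e : El X ≃ El Y) → isProp (El X) → isContr (g e))

    alt-contr : {B : Set} (S : El X ≃ B → Set ℓ) (e : El X ≃ B) → isProp (El X) →
                isContr (Alt S e)
    alt-contr S e X-prop = inl X-prop , isProp-Or (inl X-prop)

    -- Over a propositional Y the code families agree: all their codes are
    -- contractible, hence equal by univalence for contractible types.
    CodeFamily-prop : (Y : hSet) → isProp (El Y) → isProp (CodeFamily Y)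
    CodeFamily-prop Y Y-prop (g₁ , g₁-contr) (g₂ , g₂-contr) =
      Σ≡prop (λ g → isProp-Π (λ e → isProp-Π (λ _ → isProp-isContr)))
        (funext fe (λ e → let X-prop = ≃-reflects-prop e Y-prop
                          in contr-≡ (g₁-contr e X-prop) (g₂-contr e X-prop)))

    code-N : (m : M) → CodeFamily (N m)
    code-N m = Alt (S μN m) , alt-contr (S μN m)

    code-Π : (A : hSet) (B : El A → hSet) (wA : inV A) (wB : (a : El A) → inV (B a)) →
             CodeFamily A → ((a : El A) → CodeFamily (B a)) → CodeFamily (Πˢ fe A B)
    code-Π A B wA wB _ _ = Alt (S μΠ (argsOf A B wA wB)) , alt-contr (S μΠ (argsOf A B wA wB))

    code-ua : (Y : hSet) (Y-prop : isProp (El Y)) (w₀ w₁ : inV Y) (c₀ c₁ : CodeFamily Y) →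
              subst (λ _ → CodeFamily Y) (uaW Y Y-prop w₀ w₁) c₀ ≡ c₁
    code-ua Y Y-prop w₀ w₁ c₀ c₁ = trans (subst-const (uaW Y Y-prop w₀ w₁) c₀) (CodeFamily-prop Y Y-prop c₀ c₁)

    code : (Y : hSet) → inV Y → CodeFamily Y
    code = elim (λ Y _ → CodeFamily Y) code-N code-Π code-ua

    R : V → Set₂
    R (Y , w) = Σ (El X ≃ El Y) (proj₁ (code Y w))

    R-at-N : (m : M) → R (conN m) ≡ Σ (El X ≃ El (N m)) (Alt (S μN m))
    R-at-N m = cong (λ c → Σ _ (proj₁ c)) (elim-wN (λ Y _ → CodeFamily Y) code-N code-Π code-ua m)

    R-at-Π : (A : hSet) (B : El A → hSet) (wA : inV A) (wB : (a : El A) → inV (B a)) →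
             R (Πˢ fe A B , wΠ A B wA wB) ≡ Σ (El X ≃ El (Πˢ fe A B)) (Alt (S μΠ (argsOf A B wA wB)))
    R-at-Π A B wA wB = cong (λ c → Σ _ (proj₁ c)) (elim-wΠ (λ Y _ → CodeFamily Y) code-N code-Π code-ua A B wA wB)

    -- At a constructor the codes form a proposition: two of them carry the
    -- same map, by extensionality if X is a proposition and by S-uniq otherwise.
    alts-prop : {T : Set ℓ} {con : T → V} (μ : Matching x con) (t : T) →
                isProp (Σ (El X ≃ El (proj₁ (con t))) (Alt (S μ t)))
    alts-prop {ℓ = ℓ} {con = con} μ t (e₁ , o₁) (e₂ , o₂) =
      Σ≡prop (λ _ → isProp-Or) (equiv-≡ (lower (o₁ SameMap SameMap-prop viaProp
        (λ s₁ → o₂ SameMap SameMap-prop viaProp (λ s₂ → lift (S-uniq μ t s₁ s₂))))))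
      where
      SameMap : Set (lsuc lzero ⊔ ℓ)
      SameMap = Lift (lsuc lzero ⊔ ℓ) (proj₁ e₁ ≡ proj₁ e₂)
      SameMap-prop : isProp SameMap
      SameMap-prop (lift p) (lift q) = cong lift (isSet-Π fe (λ _ → proj₂ (proj₁ (con t))) _ _ p q)
      viaProp : isProp (El X) → SameMap
      viaProp X-prop = lift (funext fe (λ z → ≃-preserves-prop e₁ X-prop _ _))

    -- At a constructor a code decodes to a path: both disjuncts give one,
    -- and over a proposition X the paths from x form a proposition.
    alts-decode : {T : Set ℓ} {con : T → V} (μ : Matching x con) (t : T) →
                  Σ (El X ≃ El (proj₁ (con t))) (Alt (S μ t)) → x ≡ con t
    alts-decode μ t (e , o) =
      Or-elim (S-prop μ t e) (λ X-prop → propPaths X-prop (proj₂ x) _)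
        (λ X-prop → pathFromEquiv (proj₂ x) _ X-prop e) (S-dec μ t e) o

    -- R is proposition-valued and decodes to paths; both are checked at
    -- point constructors, the uaW cases being propositions.
    R-prop : (v : V) → isProp (R v)
    R-prop (Y , w) = elim (λ Y w → isProp (R (Y , w)))
      (λ m → subst isProp (sym (R-at-N m)) (alts-prop μN m))
      (λ A B wA wB _ _ → subst isProp (sym (R-at-Π A B wA wB)) (alts-prop μΠ (argsOf A B wA wB)))
      (λ _ _ _ _ _ _ → isProp-isProp _ _) Y w

    decode : (v : V) → R v → x ≡ v
    decode (Y , w) = elim (λ Y w → R (Y , w) → x ≡ (Y , w))
      (λ m r → alts-decode μN m (subst id (R-at-N m) r))
      (λ A B wA wB _ _ r → alts-decode μΠ (argsOf A B wA wB) (subst id (R-at-Π A B wA wB) r))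
      (λ Y Y-prop _ w₁ _ _ → isProp-Π (λ _ → isProp-sym (propPaths Y-prop w₁ x)) _ _) Y w

    codeN : (m : M) (e : El X ≃ El (N m)) → S μN m e → R (conN m)
    codeN m e s = subst id (sym (R-at-N m)) (e , inr s)

    codeΠ : (A : hSet) (B : El A → hSet) (wA : inV A) (wB : (a : El A) → inV (B a))
            (e : El X ≃ El (Πˢ fe A B)) → S μΠ (argsOf A B wA wB) e → R (Πˢ fe A B , wΠ A B wA wB)
    codeΠ A B wA wB e s = subst id (sym (R-at-Π A B wA wB)) (e , inr s)

    paths-prop : R x → (v : V) → isProp (x ≡ v)
    paths-prop r = pathsProp-fromCode R R-prop r decode

  PathsProp : (X : hSet) → inV X → Set₁
  PathsProp X w = (v : V) → isProp ((X , w) ≡ v)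

  -- x = conN m: a code at conN m' is a path m ≡ m' in the set M.
  pathsProp-N : (m : M) → PathsProp (N m) (wN m)
  pathsProp-N m = paths-prop (codeN m (idEquiv _) (refl , refl))
    where open Codes (conN m) (matchBy conN m (M-set m)) noMatch

  -- x = conΠ t₀: a code at conΠ t is a path t₀ ≡ t of arguments, and such
  -- paths form propositions by the induction hypotheses.
  pathsProp-Π : (A : hSet) (B : El A → hSet) (wA : inV A) (wB : (a : El A) → inV (B a)) →
                PathsProp A wA → ((a : El A) → PathsProp (B a) (wB a)) →
                PathsProp (Πˢ fe A B) (wΠ A B wA wB)
  pathsProp-Π A B wA wB ih-A ih-B = paths-prop (codeΠ A B wA wB (idEquiv _) (refl , refl))
    where
    args-paths : (t : ΠArgs) → isProp (argsOf A B wA wB ≡ t)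
    args-paths = Σ-pathsProp ih-A (λ b → funPathsProp (λ a → ih-B a (b a)))
    open Codes (conΠ (argsOf A B wA wB)) noMatch (matchBy conΠ (argsOf A B wA wB) args-paths)

  V-isSet : isSet V
  V-isSet (X , w) = elim PathsProp pathsProp-N pathsProp-Π
    (λ _ _ _ _ _ _ → isProp-Π (λ _ → isProp-isProp) _ _) X w

proposition2p9 : (fe : Funext) → UnivalentSets → ContrUnivalence →
    (M : Set) → isSet M → (N : M → hSet) → (I : InV fe M N) →
    isSet (Σ hSet (InV.inV I))
proposition2p9 = Proof.V-isSet
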